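{- If $f:H=\prod_{i\in I} H_i\to K$ is a surjective homomorphism of groups, and $K$ has chain condition on almost direct factors, then there exist finitely many ultrafilters $\mathcal{U}_0,\dots,\mathcal{U}_{n-1}$ on $I$ such that the composite map $H\to K\to K/Z(K)$ (of $f$ with the quotient map) factors through the natural map $H\to H/\mathcal{U}_0\times\dots\times H/\mathcal{U}_{n-1}$.
   Context: $Z(K)$ denotes the center of the group $K$. Two normal subgroups $K_0,K_1$ of $K$ are called almost direct factors of $K$ if each is the centralizer in $K$ of the other and $K_0K_1=K$; each such subgroup is called an almost direct factor of $K$. $K$ has chain condition on almost direct factors if every ascending chain of almost direct factors of $K$ terminates (equivalently, every descending chain of such subgroups terminates). An ultrafilter on $I$ is a maximal proper filter of subsets of $I$. For an ultrafilter $\mathcal{U}$ on $I$, $H/\mathcal{U}$ denotes the ultraproduct: the quotient of $\prod_{i\in I} H_i$ by the relation $(a_i)\sim(b_i)$ iff $\{i\mid a_i=b_i\}\in\mathcal{U}$, with induced group structure. The case $n=0$ is allowed, the empty product being the trivial group. -}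

module Defs where

open import Algebra.Bundles using (Group)
open import Algebra.Morphism.Bundles using (GroupHomomorphism)
import Algebra.Properties.Group as GroupProperties
open import Data.Empty.Polymorphic using (⊥)
open import Data.Fin.Base using (Fin)
open import Data.Nat.Base using (ℕ; suc; _≥_)
open import Data.Product.Base using (∃; ∃₂; _×_; _,_)
open import Data.Unit.Polymorphic using (⊤)
open import Level using (Level; _⊔_) renaming (suc to lsuc)
open import Relation.Binary.Definitions using (_Respects_)
open import Relation.Nullary.Negation.Core using (¬_)
open import Relation.Unary using (Pred; _∈_; _⊆_; _≐_; _∩_)
import Relation.Binary.Reasoning.Setoid as SetoidReasoning

private
  variable
    i c ℓ k r p : Level

module _ (G : Group k r) where
  open Group G

  record IsNormalSubgroup (N : Pred Carrier p) : Set (k ⊔ r ⊔ p) where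
    field
      resp       : N Respects _≈_
      ε∈         : ε ∈ N
      ∙-closed   : ∀ {x y} → x ∈ N → y ∈ N → x ∙ y ∈ N
      ⁻¹-closed  : ∀ {x} → x ∈ N → x ⁻¹ ∈ N
      conjugates : ∀ g {x} → x ∈ N → g ∙ x ∙ g ⁻¹ ∈ N

  Centralizer : Pred Carrier p → Pred Carrier (k ⊔ r ⊔ p)
  Centralizer S x = ∀ {y} → y ∈ S → x ∙ y ≈ y ∙ x

  Center : Pred Carrier (k ⊔ r)
  Center x = ∀ y → x ∙ y ≈ y ∙ x

  record AreAlmostDirectFactors (K₀ K₁ : Pred Carrier (k ⊔ r)) : Set (k ⊔ r) where
    field
      normal₀      : IsNormalSubgroup K₀
      normal₁      : IsNormalSubgroup K₁
      centralizer₀ : K₀ ≐ Centralizer K₁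
      centralizer₁ : K₁ ≐ Centralizer K₀
      product      : ∀ x → ∃₂ λ a b → a ∈ K₀ × b ∈ K₁ × x ≈ a ∙ b

  IsAlmostDirectFactor : Pred Carrier (k ⊔ r) → Set (lsuc (k ⊔ r))
  IsAlmostDirectFactor K₀ = ∃ λ K₁ → AreAlmostDirectFactors K₀ K₁

  ChainConditionOnAlmostDirectFactors : Set (lsuc (k ⊔ r))
  ChainConditionOnAlmostDirectFactors =
    (C : ℕ → Pred Carrier (k ⊔ r)) →
    (∀ n → IsAlmostDirectFactor (C n)) →
    (∀ n → C n ⊆ C (suc n)) →
    ∃ λ N → ∀ n → n ≥ N → C n ≐ C N

  module _ {N : Pred Carrier p} (normal : IsNormalSubgroup N) where
    open IsNormalSubgroup normal
    open GroupProperties G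
    open SetoidReasoning setoid

    private
      reflexive-∈ : ∀ {x y} → x ≈ y → x ∙ y ⁻¹ ∈ N
      reflexive-∈ {x} {y} x≈y =
        resp (trans (sym (inverseʳ y)) (∙-congʳ (sym x≈y))) ε∈

      sym-∈ : ∀ {x y} → x ∙ y ⁻¹ ∈ N → y ∙ x ⁻¹ ∈ N
      sym-∈ {x} {y} h = resp
        (trans (⁻¹-anti-homo-∙ x (y ⁻¹)) (∙-congʳ (⁻¹-involutive y)))
        (⁻¹-closed h)

      trans-∈ : ∀ {x y z} → x ∙ y ⁻¹ ∈ N → y ∙ z ⁻¹ ∈ N → x ∙ z ⁻¹ ∈ N
      trans-∈ {x} {y} {z} h₁ h₂ = resp eq (∙-closed h₁ h₂)
        where
        eq : x ∙ y ⁻¹ ∙ (y ∙ z ⁻¹) ≈ x ∙ z ⁻¹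
        eq = begin
          x ∙ y ⁻¹ ∙ (y ∙ z ⁻¹)   ≈⟨ assoc x (y ⁻¹) (y ∙ z ⁻¹) ⟩
          x ∙ (y ⁻¹ ∙ (y ∙ z ⁻¹)) ≈⟨ ∙-congˡ (\\-leftDividesʳ y (z ⁻¹)) ⟩
          x ∙ z ⁻¹                ∎

      ∙-cong-∈ : ∀ {x y u v} → x ∙ y ⁻¹ ∈ N → u ∙ v ⁻¹ ∈ N →
                 x ∙ u ∙ (y ∙ v) ⁻¹ ∈ N
      ∙-cong-∈ {x} {y} {u} {v} h₁ h₂ = resp eq (∙-closed (conjugates x h₂) h₁)
        where
        eq : x ∙ (u ∙ v ⁻¹) ∙ x ⁻¹ ∙ (x ∙ y ⁻¹) ≈ x ∙ u ∙ (y ∙ v) ⁻¹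
        eq = begin
          x ∙ (u ∙ v ⁻¹) ∙ x ⁻¹ ∙ (x ∙ y ⁻¹)   ≈⟨ assoc _ _ _ ⟩
          x ∙ (u ∙ v ⁻¹) ∙ (x ⁻¹ ∙ (x ∙ y ⁻¹)) ≈⟨ ∙-congˡ (\\-leftDividesʳ x (y ⁻¹)) ⟩
          x ∙ (u ∙ v ⁻¹) ∙ y ⁻¹                ≈⟨ ∙-congʳ (assoc x u (v ⁻¹)) ⟨
          x ∙ u ∙ v ⁻¹ ∙ y ⁻¹                  ≈⟨ assoc _ _ _ ⟩
          x ∙ u ∙ (v ⁻¹ ∙ y ⁻¹)                ≈⟨ ∙-congˡ (⁻¹-anti-homo-∙ y v) ⟨
          x ∙ u ∙ (y ∙ v) ⁻¹                   ∎

      ⁻¹-cong-∈ : ∀ {x y} → x ∙ y ⁻¹ ∈ N → x ⁻¹ ∙ (y ⁻¹) ⁻¹ ∈ N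
      ⁻¹-cong-∈ {x} {y} h = resp eq (conjugates (x ⁻¹) (sym-∈ h))
        where
        eq : x ⁻¹ ∙ (y ∙ x ⁻¹) ∙ (x ⁻¹) ⁻¹ ≈ x ⁻¹ ∙ (y ⁻¹) ⁻¹
        eq = begin
          x ⁻¹ ∙ (y ∙ x ⁻¹) ∙ (x ⁻¹) ⁻¹   ≈⟨ assoc _ _ _ ⟩
          x ⁻¹ ∙ (y ∙ x ⁻¹ ∙ (x ⁻¹) ⁻¹)   ≈⟨ ∙-congˡ (//-rightDividesʳ (x ⁻¹) y) ⟩
          x ⁻¹ ∙ y                        ≈⟨ ∙-congˡ (⁻¹-involutive y) ⟨
          x ⁻¹ ∙ (y ⁻¹) ⁻¹                ∎

    quotient : Group k p
    quotient = record
      { Carrier = Carrier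
      ; _≈_     = λ x y → x ∙ y ⁻¹ ∈ N
      ; _∙_     = _∙_
      ; ε       = ε
      ; _⁻¹     = _⁻¹
      ; isGroup = record
        { isMonoid = record
          { isSemigroup = record
            { isMagma = record
              { isEquivalence = record
                { refl  = reflexive-∈ refl
                ; sym   = sym-∈
                ; trans = trans-∈
                }
              ; ∙-cong = ∙-cong-∈
              }
            ; assoc = λ x y z → reflexive-∈ (assoc x y z)
            }
          ; identity = (λ x → reflexive-∈ (identityˡ x))
                     , (λ x → reflexive-∈ (identityʳ x))
          }
        ; inverse = (λ x → reflexive-∈ (inverseˡ x))
                  , (λ x → reflexive-∈ (inverseʳ x))
        ; ⁻¹-cong = ⁻¹-cong-∈
        }
      }

    quotientMap : GroupHomomorphism rawGroup (Group.rawGroup quotient)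
    quotientMap = record
      { ⟦_⟧ = λ x → x
      ; isGroupHomomorphism = record
        { isMonoidHomomorphism = record
          { isMagmaHomomorphism = record
            { isRelHomomorphism = record { cong = reflexive-∈ }
            ; homo = λ _ _ → reflexive-∈ refl
            }
          ; ε-homo = reflexive-∈ refl
          }
        ; ⁻¹-homo = λ _ → reflexive-∈ refl
        }
      }

  center-isNormalSubgroup : IsNormalSubgroup Center
  center-isNormalSubgroup = record
    { resp       = resp′
    ; ε∈         = λ y → trans (identityˡ y) (sym (identityʳ y))
    ; ∙-closed   = λ {x} {z} hx hz y → begin
        x ∙ z ∙ y   ≈⟨ assoc x z y ⟩
        x ∙ (z ∙ y) ≈⟨ ∙-congˡ (hz y) ⟩
        x ∙ (y ∙ z) ≈⟨ assoc x y z ⟨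
        x ∙ y ∙ z   ≈⟨ ∙-congʳ (hx y) ⟩
        y ∙ x ∙ z   ≈⟨ assoc y x z ⟩
        y ∙ (x ∙ z) ∎
    ; ⁻¹-closed  = λ {x} hx y → begin
        x ⁻¹ ∙ y                ≈⟨ ∙-congˡ (//-rightDividesʳ x y) ⟨
        x ⁻¹ ∙ (y ∙ x ∙ x ⁻¹)   ≈⟨ ∙-congˡ (∙-congʳ (hx y)) ⟨
        x ⁻¹ ∙ (x ∙ y ∙ x ⁻¹)   ≈⟨ ∙-congˡ (assoc x y (x ⁻¹)) ⟩
        x ⁻¹ ∙ (x ∙ (y ∙ x ⁻¹)) ≈⟨ \\-leftDividesʳ x (y ∙ x ⁻¹) ⟩
        y ∙ x ⁻¹                ∎
    ; conjugates = λ g {x} hx → resp′ (begin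
        x              ≈⟨ //-rightDividesʳ g x ⟨
        x ∙ g ∙ g ⁻¹   ≈⟨ ∙-congʳ (hx g) ⟩
        g ∙ x ∙ g ⁻¹   ∎) hx
    }
    where
    open GroupProperties G
    open SetoidReasoning setoid

    resp′ : Center Respects _≈_
    resp′ x≈z hx y = trans (∙-congʳ (sym x≈z)) (trans (hx y) (∙-congˡ x≈z))

_/Z : Group k r → Group k (k ⊔ r)
K /Z = quotient K (center-isNormalSubgroup K)

toModCenter : (K : Group k r) →
              GroupHomomorphism (Group.rawGroup K) (Group.rawGroup (K /Z))
toModCenter K = quotientMap K (center-isNormalSubgroup K)

-- Subsets of I are predicates at one fixed level p, so that collections of
-- subsets can be compared. Below, p is the level of the equality of the
-- groups H j, which makes { j ∣ a j ≈ b j } such a subset.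

module _ {I : Set i} where

  record IsFilter (F : Pred (Pred I p) p) : Set (i ⊔ lsuc p) where
    field
      full     : (λ _ → ⊤) ∈ F
      ∩-closed : ∀ {A B} → A ∈ F → B ∈ F → A ∩ B ∈ F
      ⊆-closed : ∀ {A B} → A ⊆ B → A ∈ F → B ∈ F

  IsProper : Pred (Pred I p) p → Set p
  IsProper F = ¬ ((λ _ → ⊥) ∈ F)

  record IsUltrafilter (F : Pred (Pred I p) p) : Set (i ⊔ lsuc p) where
    field
      isFilter : IsFilter F
      isProper : IsProper F
      maximal  : ∀ (F′ : Pred (Pred I p) p) → IsFilter F′ → IsProper F′ →
                 F ⊆ F′ → F′ ⊆ F

    open IsFilter isFilter public

record Ultrafilter (I : Set i) (p : Level) : Set (i ⊔ lsuc p) where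
  field
    sets          : Pred (Pred I p) p
    isUltrafilter : IsUltrafilter sets

  open IsUltrafilter isUltrafilter public

module _ {I : Set i} (H : I → Group c ℓ) where
  private
    module H j = Group (H j)

  ∏ : Group (i ⊔ c) (i ⊔ ℓ)
  ∏ = record
    { Carrier = ∀ j → H.Carrier j
    ; _≈_     = λ a b → ∀ j → H._≈_ j (a j) (b j)
    ; _∙_     = λ a b j → H._∙_ j (a j) (b j)
    ; ε       = λ j → H.ε j
    ; _⁻¹     = λ a j → H._⁻¹ j (a j)
    ; isGroup = record
      { isMonoid = record
        { isSemigroup = record
          { isMagma = record
            { isEquivalence = record
              { refl  = λ j → H.refl j
              ; sym   = λ e j → H.sym j (e j)
              ; trans = λ e e′ j → H.trans j (e j) (e′ j)
              }
            ; ∙-cong = λ e e′ j → H.∙-cong j (e j) (e′ j)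
            }
          ; assoc = λ x y z j → H.assoc j (x j) (y j) (z j)
          }
        ; identity = (λ x j → H.identityˡ j (x j)) , (λ x j → H.identityʳ j (x j))
        }
      ; inverse = (λ x j → H.inverseˡ j (x j)) , (λ x j → H.inverseʳ j (x j))
      ; ⁻¹-cong = λ e j → H.⁻¹-cong j (e j)
      }
    }

  module _ (𝒰 : Ultrafilter I ℓ) where
    open Ultrafilter 𝒰

    private
      everywhere : ∀ {A : Pred I ℓ} → (∀ j → j ∈ A) → A ∈ sets
      everywhere all = ⊆-closed (λ {j} _ → all j) full

    ultraproduct : Group (i ⊔ c) ℓ
    ultraproduct = record
      { Carrier = ∀ j → H.Carrier j
      ; _≈_     = λ a b → (λ j → H._≈_ j (a j) (b j)) ∈ sets
      ; _∙_     = Group._∙_ ∏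
      ; ε       = Group.ε ∏
      ; _⁻¹     = Group._⁻¹ ∏
      ; isGroup = record
        { isMonoid = record
          { isSemigroup = record
            { isMagma = record
              { isEquivalence = record
                { refl  = everywhere (λ j → H.refl j)
                ; sym   = ⊆-closed (λ {j} → H.sym j)
                ; trans = λ e e′ →
                    ⊆-closed (λ {j} (d , d′) → H.trans j d d′) (∩-closed e e′)
                }
              ; ∙-cong = λ e e′ →
                  ⊆-closed (λ {j} (d , d′) → H.∙-cong j d d′) (∩-closed e e′)
              }
            ; assoc = λ x y z → everywhere (Group.assoc ∏ x y z)
            }
          ; identity = (λ x → everywhere (Group.identityˡ ∏ x))
                     , (λ x → everywhere (Group.identityʳ ∏ x))
          }
        ; inverse = (λ x → everywhere (Group.inverseˡ ∏ x))
                  , (λ x → everywhere (Group.inverseʳ ∏ x))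
        ; ⁻¹-cong = ⊆-closed (λ {j} → H.⁻¹-cong j)
        }
      }

    toUltraproduct : GroupHomomorphism (Group.rawGroup ∏) (Group.rawGroup ultraproduct)
    toUltraproduct = record
      { ⟦_⟧ = λ a → a
      ; isGroupHomomorphism = record
        { isMonoidHomomorphism = record
          { isMagmaHomomorphism = record
            { isRelHomomorphism = record { cong = everywhere }
            ; homo = λ _ _ → everywhere (λ j → H.refl j)
            }
          ; ε-homo = everywhere (λ j → H.refl j)
          }
        ; ⁻¹-homo = λ _ → everywhere (λ j → H.refl j)
        }
      }

module _ {J : Set i} (A : Group k r) (B : J → Group c ℓ) where

  tuple : (∀ j → GroupHomomorphism (Group.rawGroup A) (Group.rawGroup (B j))) →
          GroupHomomorphism (Group.rawGroup A) (Group.rawGroup (∏ B))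
  tuple φ = record
    { ⟦_⟧ = λ a j → φ.⟦_⟧ j a
    ; isGroupHomomorphism = record
      { isMonoidHomomorphism = record
        { isMagmaHomomorphism = record
          { isRelHomomorphism = record { cong = λ e j → φ.⟦⟧-cong j e }
          ; homo = λ a b j → φ.homo j a b
          }
        ; ε-homo = λ j → φ.ε-homo j
        }
      ; ⁻¹-homo = λ a j → φ.⁻¹-homo j a
      }
    }
    where module φ j = GroupHomomorphism (φ j)

module _ {I : Set i} (H : I → Group c ℓ) {n : ℕ} (𝒰 : Fin n → Ultrafilter I ℓ) where

  ∏ultraproducts : Group (i ⊔ c) ℓ
  ∏ultraproducts = ∏ (λ m → ultraproduct H (𝒰 m))

  to∏ultraproducts :
    GroupHomomorphism (Group.rawGroup (∏ H)) (Group.rawGroup ∏ultraproducts)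
  to∏ultraproducts =
    tuple (∏ H) (λ m → ultraproduct H (𝒰 m)) (λ m → toUltraproduct H (𝒰 m))

{-# OPTIONS --safe #-}
-- Call A ⊆ I large if f h is central whenever h is trivial on A; the large
-- sets form a filter, and f h and f h′ agree modulo the center as soon as h
-- and h′ agree on a large set.  The centralizer in K of
-- { f h ∣ h trivial on A } is an almost direct factor which grows with A,
-- and for A ⊆ A′ it grows strictly unless A ∪ ∁ A′ is large.
-- If A is not large and A ∪ B or A ∪ ∁ B is large for each B, then
-- { B ∣ A ∪ B large } is an ultrafilter; otherwise A is the intersection of
-- some A ∪ B and A ∪ ∁ B, neither of which is large.  By the chain
-- condition, repeated splitting from A = ∅ stops, so the filter of large sets
-- is an intersection of finitely many ultrafilters that contain disjoint sets,
-- and disjointness makes H → ∏ₘ H/𝒰ₘ surjective.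
module Submission where

open import Defs
open import Algebra.Bundles using (Group)
open import Algebra.Morphism.Bundles using (GroupHomomorphism)
open import Algebra.Morphism.Construct.Composition using (groupHomomorphism)
import Algebra.Properties.Group as GroupProperties
open import Axiom.ExcludedMiddle using (ExcludedMiddle)
open import Data.Empty.Polymorphic using (⊥)
open import Data.Fin.Base using (Fin; splitAt; _↑ˡ_; _↑ʳ_)
open import Data.Fin.Properties using (splitAt⁻¹-↑ˡ; splitAt⁻¹-↑ʳ)
open import Data.Nat.Base using (ℕ; zero; suc; _+_)
open import Data.Nat.Properties using (n≤1+n)
open import Data.Product.Base using (Σ-syntax; ∃; ∃₂; _×_; _,_; proj₁; proj₂)
open import Data.Sum.Base using (_⊎_; inj₁; inj₂; [_,_])
open import Data.Vec.Functional using (Vector; _++_)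
open import Data.Vec.Functional.Relation.Unary.All.Properties using (++⁻)
open import Function.Base using (_∘_; id)
open import Function.Definitions using (Surjective; StrictlySurjective)
open import Level using (Level; Lift; lift; lower; _⊔_) renaming (suc to lsuc)
open import Relation.Binary.PropositionalEquality.Core using (subst)
import Relation.Binary.Reasoning.Setoid as SetoidReasoning
open import Relation.Nullary.Decidable.Core
  using (yes; no; True; toWitness; fromWitness; decidable-stable; toSum)
open import Relation.Nullary.Negation.Core using (¬_; contradiction)
open import Relation.Unary using (Pred; _∈_; _∉_; _⊆_; _≐_; _∩_; _∪_; ∁)

private
  variable
    a b c ℓ i k r p q s t : Level

-- `P` also sees the index, because in `join` the element to be matched, `y m`, varies with it.
++-elim : ∀ {X : Set a} {m n} (P : Fin (m + n) → X → Set p)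
          (xs : Vector X m) (ys : Vector X n) →
          (∀ j → P (j ↑ˡ n) (xs j)) → (∀ j → P (m ↑ʳ j) (ys j)) →
          ∀ j → P j ((xs ++ ys) j)
++-elim {m = m} P xs ys pxs pys j with splitAt m j in eq
... | inj₁ j′ = subst (λ j → P j (xs j′)) (splitAt⁻¹-↑ˡ eq) (pxs j′)
... | inj₂ j′ = subst (λ j → P j (ys j′)) (splitAt⁻¹-↑ʳ {m} eq) (pys j′)

-- Centralizers and almost direct factors.

module _ (G : Group k r) where
  open Group G
  open GroupProperties G
  open SetoidReasoning setoid

  commutes-∙ : ∀ {x y z} → x ∙ y ≈ y ∙ x → x ∙ z ≈ z ∙ x → x ∙ (y ∙ z) ≈ y ∙ z ∙ x
  commutes-∙ {x} {y} {z} xy≈yx xz≈zx = begin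
    x ∙ (y ∙ z) ≈⟨ assoc x y z ⟨
    x ∙ y ∙ z   ≈⟨ ∙-congʳ xy≈yx ⟩
    y ∙ x ∙ z   ≈⟨ assoc y x z ⟩
    y ∙ (x ∙ z) ≈⟨ ∙-congˡ xz≈zx ⟩
    y ∙ (z ∙ x) ≈⟨ assoc y z x ⟨
    y ∙ z ∙ x   ∎

  commutes-cancelˡ : ∀ {x y z} → x ∙ y ≈ y ∙ x → x ∙ (y ∙ z) ≈ y ∙ z ∙ x → x ∙ z ≈ z ∙ x
  commutes-cancelˡ {x} {y} {z} xy≈yx xyz≈yzx = ∙-cancelˡ y (x ∙ z) (z ∙ x) (begin
    y ∙ (x ∙ z) ≈⟨ assoc y x z ⟨
    y ∙ x ∙ z   ≈⟨ ∙-congʳ xy≈yx ⟨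
    x ∙ y ∙ z   ≈⟨ assoc x y z ⟩
    x ∙ (y ∙ z) ≈⟨ xyz≈yzx ⟩
    y ∙ z ∙ x   ≈⟨ assoc y z x ⟩
    y ∙ (z ∙ x) ∎)

  commutes-respʳ : ∀ {x y z} → y ≈ z → x ∙ y ≈ y ∙ x → x ∙ z ≈ z ∙ x
  commutes-respʳ y≈z xy≈yx = trans (∙-congˡ (sym y≈z)) (trans xy≈yx (∙-congʳ y≈z))

  ClosedUnderConjugation : Pred Carrier s → Set (k ⊔ s)
  ClosedUnderConjugation S = ∀ g {x} → x ∈ S → g ∙ x ∙ g ⁻¹ ∈ S

  centralizer-isNormalSubgroup : {S : Pred Carrier s} → ClosedUnderConjugation S →
                                 IsNormalSubgroup G (Centralizer G S)
  centralizer-isNormalSubgroup {S = S} conj = record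
    { resp       = λ x≈z hx y∈S → sym (commutes-respʳ x≈z (sym (hx y∈S)))
    ; ε∈         = λ {y} _ → trans (identityˡ y) (sym (identityʳ y))
    ; ∙-closed   = λ hx hz y∈S → sym (commutes-∙ (sym (hx y∈S)) (sym (hz y∈S)))
    -- `y` commutes with `x` and with `x ∙ x ⁻¹ ≈ ε`; cancel `x`.
    ; ⁻¹-closed  = λ {x} hx {y} y∈S → sym (commutes-cancelˡ (sym (hx y∈S))
        (commutes-respʳ (sym (inverseʳ x)) (trans (identityʳ y) (sym (identityˡ y)))))
    -- `y′` is a conjugate of `y`, so it is in `S` and commutes with `x`; conjugating this relation
    -- by `g` turns `y′` back into `y`.
    ; conjugates = λ g {x} hx {y} y∈S →
        let y′ = g ⁻¹ ∙ y ∙ g ⁻¹ ⁻¹ in begin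
        g ∙ x ∙ g ⁻¹ ∙ y      ≈⟨ assoc (g ∙ x) (g ⁻¹) y ⟩
        g ∙ x ∙ (g ⁻¹ ∙ y)    ≈⟨ ∙-congˡ (//-rightDividesˡ (g ⁻¹) (g ⁻¹ ∙ y)) ⟨
        g ∙ x ∙ (y′ ∙ g ⁻¹)   ≈⟨ assoc (g ∙ x) y′ (g ⁻¹) ⟨
        g ∙ x ∙ y′ ∙ g ⁻¹     ≈⟨ ∙-congʳ (assoc g x y′) ⟩
        g ∙ (x ∙ y′) ∙ g ⁻¹   ≈⟨ ∙-congʳ (∙-congˡ (hx (conj (g ⁻¹) y∈S))) ⟩
        g ∙ (y′ ∙ x) ∙ g ⁻¹   ≈⟨ ∙-congʳ (assoc g y′ x) ⟨
        g ∙ y′ ∙ x ∙ g ⁻¹     ≈⟨ ∙-congʳ (∙-congʳ (begin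
          g ∙ (g ⁻¹ ∙ y ∙ g ⁻¹ ⁻¹)   ≈⟨ ∙-congˡ (assoc (g ⁻¹) y (g ⁻¹ ⁻¹)) ⟩
          g ∙ (g ⁻¹ ∙ (y ∙ g ⁻¹ ⁻¹)) ≈⟨ \\-leftDividesˡ g (y ∙ g ⁻¹ ⁻¹) ⟩
          y ∙ g ⁻¹ ⁻¹                ≈⟨ ∙-congˡ (⁻¹-involutive g) ⟩
          y ∙ g                      ∎)) ⟩
        y ∙ g ∙ x ∙ g ⁻¹      ≈⟨ ∙-congʳ (assoc y g x) ⟩
        y ∙ (g ∙ x) ∙ g ⁻¹    ≈⟨ assoc y (g ∙ x) (g ⁻¹) ⟩
        y ∙ (g ∙ x ∙ g ⁻¹)    ∎
    }

  isNormalSubgroup-resp-≐ : {M : Pred Carrier p} {N : Pred Carrier q} → M ≐ N →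
                            IsNormalSubgroup G N → IsNormalSubgroup G M
  isNormalSubgroup-resp-≐ (M⊆N , N⊆M) N-normal = record
    { resp       = λ x≈y → N⊆M ∘ resp x≈y ∘ M⊆N
    ; ε∈         = N⊆M ε∈
    ; ∙-closed   = λ x∈M y∈M → N⊆M (∙-closed (M⊆N x∈M) (M⊆N y∈M))
    ; ⁻¹-closed  = N⊆M ∘ ⁻¹-closed ∘ M⊆N
    ; conjugates = λ g → N⊆M ∘ conjugates g ∘ M⊆N
    }
    where open IsNormalSubgroup N-normal

  module _ {S : Pred Carrier s} {T : Pred Carrier t}
           (S-conj : ClosedUnderConjugation S) (T-conj : ClosedUnderConjugation T)
           (ST-commute : ∀ {x y} → x ∈ S → y ∈ T → x ∙ y ≈ y ∙ x)
           (ST-product : ∀ x → ∃₂ λ u v → u ∈ S × v ∈ T × x ≈ u ∙ v)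
           where

    -- Write `x ≈ u′ ∙ v′` and `y ≈ u ∙ v`. Both `y` and `u` commute with `v′`, hence so does `v`.
    -- As `v` also commutes with `u′`, it commutes with `x`; and `u` commutes with `x` because `x`
    -- centralizes `S`.
    centralizers-commute : ∀ {x y} → x ∈ Centralizer G S → y ∈ Centralizer G T →
                           x ∙ y ≈ y ∙ x
    centralizers-commute {x} {y} hx hy with ST-product x | ST-product y
    ... | u′ , v′ , u′∈S , v′∈T , x≈u′v′ | u , v , u∈S , v∈T , y≈uv =
      commutes-respʳ (sym y≈uv) (commutes-∙ (hx u∈S) (sym vx≈xv))
      where
      vv′≈v′v : v′ ∙ v ≈ v ∙ v′
      vv′≈v′v = commutes-cancelˡ (sym (ST-commute u∈S v′∈T))
                                 (commutes-respʳ y≈uv (sym (hy v′∈T)))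

      vx≈xv : v ∙ x ≈ x ∙ v
      vx≈xv = commutes-respʳ (sym x≈u′v′)
                (commutes-∙ (sym (ST-commute u′∈S v∈T)) (sym vv′≈v′v))

    -- Since `S` and `T` commute, each lies in the centralizer of the other, so whatever centralizes
    -- `K₁` centralizes `S`. Taking `K₀` and `K₁` only up to `≐` lets them lie at level `k ⊔ r`
    -- whatever the levels of `S` and `T`.
    centralizers-areAlmostDirectFactors :
      {K₀ K₁ : Pred Carrier (k ⊔ r)} → K₀ ≐ Centralizer G S → K₁ ≐ Centralizer G T →
      AreAlmostDirectFactors G K₀ K₁
    centralizers-areAlmostDirectFactors K₀≐CS@(K₀⊆CS , CS⊆K₀) K₁≐CT@(K₁⊆CT , CT⊆K₁) = record
      { normal₀      = isNormalSubgroup-resp-≐ K₀≐CS (centralizer-isNormalSubgroup S-conj)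
      ; normal₁      = isNormalSubgroup-resp-≐ K₁≐CT (centralizer-isNormalSubgroup T-conj)
      ; centralizer₀ = (λ x∈K₀ y∈K₁ → centralizers-commute (K₀⊆CS x∈K₀) (K₁⊆CT y∈K₁))
                     , (λ hx → CS⊆K₀ (λ y∈S → hx (CT⊆K₁ (ST-commute y∈S))))
      ; centralizer₁ = (λ y∈K₁ x∈K₀ → sym (centralizers-commute (K₀⊆CS x∈K₀) (K₁⊆CT y∈K₁)))
                     , (λ hy → CT⊆K₁ (λ x∈T → hy (CS⊆K₀ (λ y∈S → sym (ST-commute y∈S x∈T)))))
      ; product      = λ x → let u , v , u∈S , v∈T , x≈uv = ST-product x in
          v , u , CS⊆K₀ (λ y∈S → sym (ST-commute y∈S v∈T)) , CT⊆K₁ (ST-commute u∈S)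
            , trans x≈uv (ST-commute u∈S v∈T)
      }

-- Factoring a homomorphism through a surjection.

module _ {G : Group a p} {P : Group b q} {Q : Group c s}
         (φ : GroupHomomorphism (Group.rawGroup G) (Group.rawGroup P))
         (ψ : GroupHomomorphism (Group.rawGroup G) (Group.rawGroup Q))
         where
  private
    module G = Group G
    module P = Group P
    module Q = Group Q
    module φ = GroupHomomorphism φ
    module ψ = GroupHomomorphism ψ

  -- Apply `ψ` to a chosen preimage: the value does not depend on the choice, so the homomorphism
  -- laws carry over from `ψ`.
  factor-through-surjection :
    StrictlySurjective P._≈_ φ.⟦_⟧ →
    (∀ {x y} → φ.⟦ x ⟧ P.≈ φ.⟦ y ⟧ → ψ.⟦ x ⟧ Q.≈ ψ.⟦ y ⟧) →
    Σ[ g ∈ GroupHomomorphism P.rawGroup Q.rawGroup ]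
      (∀ x → GroupHomomorphism.⟦_⟧ g φ.⟦ x ⟧ Q.≈ ψ.⟦ x ⟧)
  factor-through-surjection surj φ≈⇒ψ≈ = record
    { ⟦_⟧ = λ y → ψ.⟦ section y ⟧
    ; isGroupHomomorphism = record
      { isMonoidHomomorphism = record
        { isMagmaHomomorphism = record
          { isRelHomomorphism = record
            { cong = λ {x} {y} x≈y → φ≈⇒ψ≈ (P.trans (φ-section x) (P.trans x≈y (P.sym (φ-section y)))) }
          ; homo = λ x y → Q.trans
              (section-unique (P.trans (φ.homo _ _) (P.∙-cong (φ-section x) (φ-section y))))
              (ψ.homo _ _)
          }
        ; ε-homo = Q.trans (section-unique φ.ε-homo) ψ.ε-homo
        }
      ; ⁻¹-homo = λ x → Q.trans
          (section-unique (P.trans (φ.⁻¹-homo _) (P.⁻¹-cong (φ-section x))))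
          (ψ.⁻¹-homo _)
      }
    } , λ x → section-unique P.refl
    where
    section : P.Carrier → G.Carrier
    section y = proj₁ (surj y)

    φ-section : ∀ y → φ.⟦ section y ⟧ P.≈ y
    φ-section y = proj₂ (surj y)

    section-unique : ∀ {x y} → φ.⟦ x ⟧ P.≈ y → ψ.⟦ section y ⟧ Q.≈ ψ.⟦ x ⟧
    section-unique φx≈y = φ≈⇒ψ≈ (P.trans (φ-section _) (P.sym φx≈y))

module _ (em : ∀ {a} → ExcludedMiddle a) where

  -- Excluded middle moves a proposition to any universe level; the fixed
  -- levels of ultrafilters and of almost direct factors require this.
  Resize : ∀ b → Set a → Set b
  Resize b P = Lift b (True (em {P = P}))

  resize : {P : Set a} → P → Resize b P
  resize x = lift (fromWitness x)

  unresize : {P : Set a} → Resize b P → P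
  unresize x = toWitness (lower x)

  module _ {I : Set i} (H : I → Group c ℓ) (K : Group k r)
           (f : GroupHomomorphism (Group.rawGroup (∏ H)) (Group.rawGroup K))
           (f-surjective : StrictlySurjective (Group._≈_ K) (GroupHomomorphism.⟦_⟧ f))
           where
    private
      module K = Group K
      module H j = Group (H j)
      module ∏H = Group (∏ H)
      module f = GroupHomomorphism f
      module Z = IsNormalSubgroup (center-isNormalSubgroup K)

    -- Large sets and coordinatewise gluing.

    TrivialOn : Pred I p → Pred ∏H.Carrier (i ⊔ ℓ ⊔ p)
    TrivialOn A h = ∀ {j} → j ∈ A → H._≈_ j (h j) (H.ε j)

    Large : Pred I p → Set (i ⊔ c ⊔ ℓ ⊔ k ⊔ r ⊔ p)
    Large A = ∀ h → TrivialOn A h → f.⟦ h ⟧ ∈ Center K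

    glue : Pred I p → ∏H.Carrier → ∏H.Carrier → ∏H.Carrier
    glue A u v j with em {P = A j}
    ... | yes _ = u j
    ... | no  _ = v j

    glue-∈ : (A : Pred I p) (u v : ∏H.Carrier) → ∀ {j} → j ∈ A → H._≈_ j (glue A u v j) (u j)
    glue-∈ A u v {j} j∈A with em {P = A j}
    ... | yes _   = H.refl j
    ... | no  j∉A = contradiction j∈A j∉A

    glue-∉ : (A : Pred I p) (u v : ∏H.Carrier) → ∀ {j} → j ∉ A → H._≈_ j (glue A u v j) (v j)
    glue-∉ A u v {j} j∉A with em {P = A j}
    ... | yes j∈A = contradiction j∈A j∉A
    ... | no  _   = H.refl j

    -- In each coordinate one of the two factors is trivial: the first on `A`, the second off `A`.
    glue-∙ : (A : Pred I p) (h : ∏H.Carrier) →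
             h ∏H.≈ glue A ∏H.ε h ∏H.∙ glue A h ∏H.ε
    glue-∙ A h j with em {P = A j}
    ... | yes _ = H.sym j (H.identityˡ j (h j))
    ... | no  _ = H.sym j (H.identityʳ j (h j))

    f-glue : (A : Pred I p) (h : ∏H.Carrier) →
             f.⟦ h ⟧ K.≈ f.⟦ glue A ∏H.ε h ⟧ K.∙ f.⟦ glue A h ∏H.ε ⟧
    f-glue A h = K.trans (f.⟦⟧-cong (glue-∙ A h)) (f.homo _ _)

    Large-⊆ : {A : Pred I p} {B : Pred I q} → A ⊆ B → Large A → Large B
    Large-⊆ A⊆B A-large h h-trivial = A-large h (h-trivial ∘ A⊆B)

    Large-full : {A : Pred I p} → (∀ j → j ∈ A) → Large A
    Large-full full h h-trivial = Z.resp
      (K.trans (K.sym f.ε-homo) (f.⟦⟧-cong (λ j → H.sym j (h-trivial (full j))))) Z.ε∈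

    -- Split `h` along `A`. The first factor is trivial on `A`; the second is trivial off `A` and
    -- agrees with `h` on `A`, so it is trivial on `B`. Both have central images.
    Large-∩ : {A : Pred I p} {B : Pred I q} → Large A → Large B → Large (A ∩ B)
    Large-∩ {A = A} {B} A-large B-large h h-trivial =
      Z.resp (K.sym (f-glue A h))
        (Z.∙-closed (A-large _ (glue-∈ A ∏H.ε h)) (B-large _ trivial-on-B))
      where
      trivial-on-B : TrivialOn B (glue A h ∏H.ε)
      trivial-on-B {j} j∈B with em {P = A j}
      ... | yes j∈A = h-trivial (j∈A , j∈B)
      ... | no  _   = H.refl j

    -- `u ∙ v ⁻¹` is trivial wherever `u` and `v` agree.
    Large⇒congruent : ∀ u v → Large (λ j → H._≈_ j (u j) (v j)) →
                      Group._≈_ (K /Z) f.⟦ u ⟧ f.⟦ v ⟧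
    Large⇒congruent u v large = Z.resp
      (K.trans (f.homo _ _) (K.∙-congˡ (f.⁻¹-homo v)))
      (large (u ∏H.∙ v ∏H.⁻¹) (λ {j} → GroupProperties.x≈y⇒x∙y⁻¹≈ε (H j)))

    -- The almost direct factor attached to a subset of `I`.

    Image : Pred I p → Pred K.Carrier (i ⊔ c ⊔ ℓ ⊔ r ⊔ p)
    Image A x = ∃ λ h → TrivialOn A h × f.⟦ h ⟧ K.≈ x

    image-conj : (A : Pred I p) → ClosedUnderConjugation K (Image A)
    image-conj A g (h , h-trivial , fh≈x) =
      let g′ , fg′≈g = f-surjective g in
      g′ ∏H.∙ h ∏H.∙ g′ ∏H.⁻¹ ,
      (λ {j} j∈A → H.trans j
        (H.∙-congʳ j (H.trans j (H.∙-congˡ j (h-trivial j∈A)) (H.identityʳ j (g′ j))))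
        (H.inverseʳ j (g′ j))) ,
      K.trans (f.homo _ _) (K.∙-cong
        (K.trans (f.homo _ _) (K.∙-cong fg′≈g fh≈x))
        (K.trans (f.⁻¹-homo g′) (K.⁻¹-cong fg′≈g)))

    -- In each coordinate one of the two preimages is trivial.
    images-commute : (A : Pred I p) → ∀ {x y} → x ∈ Image A → y ∈ Image (∁ A) →
                     x K.∙ y K.≈ y K.∙ x
    images-commute A {x} {y} (u , u-trivial , fu≈x) (v , v-trivial , fv≈y) = begin
      x K.∙ y                 ≈⟨ K.∙-cong fu≈x fv≈y ⟨
      f.⟦ u ⟧ K.∙ f.⟦ v ⟧     ≈⟨ f.homo u v ⟨
      f.⟦ u ∏H.∙ v ⟧          ≈⟨ f.⟦⟧-cong uv≈vu ⟩
      f.⟦ v ∏H.∙ u ⟧          ≈⟨ f.homo v u ⟩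
      f.⟦ v ⟧ K.∙ f.⟦ u ⟧     ≈⟨ K.∙-cong fv≈y fu≈x ⟩
      y K.∙ x                 ∎
      where
      open SetoidReasoning K.setoid

      uv≈vu : u ∏H.∙ v ∏H.≈ v ∏H.∙ u
      uv≈vu j with em {P = A j}
      ... | yes j∈A = H.sym j (commutes-respʳ (H j) (H.sym j (u-trivial j∈A))
                        (H.trans j (H.identityʳ j _) (H.sym j (H.identityˡ j _))))
      ... | no  j∉A = commutes-respʳ (H j) (H.sym j (v-trivial j∉A))
                        (H.trans j (H.identityʳ j _) (H.sym j (H.identityˡ j _)))

    images-product : (A : Pred I p) → ∀ x →
                     ∃₂ λ u v → u ∈ Image A × v ∈ Image (∁ A) × x K.≈ u K.∙ v
    images-product A x = let h , fh≈x = f-surjective x in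
      f.⟦ glue A ∏H.ε h ⟧ , f.⟦ glue A h ∏H.ε ⟧ ,
      (_ , glue-∈ A ∏H.ε h , K.refl) , (_ , glue-∉ A h ∏H.ε , K.refl) ,
      K.trans (K.sym fh≈x) (f-glue A h)

    Factor : Pred I p → Pred K.Carrier (k ⊔ r)
    Factor A x = Resize (k ⊔ r) (x ∈ Centralizer K (Image A))

    factor-isAlmostDirectFactor : (A : Pred I p) → IsAlmostDirectFactor K (Factor A)
    factor-isAlmostDirectFactor A = Factor (∁ A) ,
      centralizers-areAlmostDirectFactors K (image-conj A) (image-conj (∁ A))
        (images-commute A) (images-product A) (unresize , resize) (unresize , resize)

    factor-mono : {A : Pred I p} {B : Pred I q} → A ⊆ B → Factor A ⊆ Factor B
    factor-mono A⊆B x∈FA = resize λ {y} (h , h-trivial , fh≈y) →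
      unresize x∈FA (h , h-trivial ∘ A⊆B , fh≈y)

    -- For `h` trivial on `A` and off `B`, the value `f h` lies in `Image (∁ B)`, hence in
    -- `Factor B` and so in `Factor A`: it commutes with `Image A`. It also lies in `Image A`, so it
    -- commutes with `Image (∁ A)`, and the product of the two images is `K`.
    factor-⊆⇒large : (A : Pred I p) (B : Pred I q) → Factor B ⊆ Factor A → Large (A ∪ ∁ B)
    factor-⊆⇒large A B FB⊆FA h h-trivial y with images-product A y
    ... | u , v , u∈ , v∈ , y≈uv = commutes-respʳ K (K.sym y≈uv) (commutes-∙ K
      (unresize (FB⊆FA (resize λ {_} w∈ →
        K.sym (images-commute B w∈ (h , h-trivial ∘ inj₂ , K.refl)))) u∈)
      (images-commute A (h , h-trivial ∘ inj₁ , K.refl) v∈))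

    -- Decompositions into ultrafilters.

    -- The field ∁∈ makes the ultrafilters obtained from A ∪ B and from
    -- A ∪ ∁ B separate, so that lifts can be glued along B.
    record Decomposition (A : Pred I ℓ) : Set (i ⊔ c ⊔ lsuc ℓ ⊔ k ⊔ r) where
      field
        size          : ℕ
        ultrafilters  : Fin size → Ultrafilter I ℓ
        ∁∈            : ∀ m → ∁ A ∈ Ultrafilter.sets (ultrafilters m)
        ∪-large       : ∀ {X} → (∀ m → X ∈ Ultrafilter.sets (ultrafilters m)) → Large (A ∪ X)
        to∏surjective : StrictlySurjective (Group._≈_ (∏ultraproducts H ultrafilters))
                          (GroupHomomorphism.⟦_⟧ (to∏ultraproducts H ultrafilters))

    large-decomposition : ∀ {A} → Large A → Decomposition A
    large-decomposition A-large = record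
      { size          = zero
      ; ultrafilters  = λ ()
      ; ∁∈            = λ ()
      ; ∪-large       = λ _ → Large-⊆ inj₁ A-large
      ; to∏surjective = λ _ → ∏H.ε , λ ()
      }

    module _ {A : Pred I ℓ} (¬A-large : ¬ Large A)
             (prime : ∀ (B : Pred I ℓ) → Large (A ∪ B) ⊎ Large (A ∪ ∁ B)) where

      -- Closure under intersection rests on `(A ∪ B) ∩ (A ∪ C) ⊆ A ∪ (B ∩ C)`, properness on
      -- `¬A-large`, maximality on `prime`.
      residual : Ultrafilter I ℓ
      residual = record
        { sets          = sets
        ; isUltrafilter = record
          { isFilter = record
            { full     = resize (Large-full (λ _ → inj₂ _))
            ; ∩-closed = λ B∈ C∈ → resize (Large-⊆
                (λ { (inj₁ j∈A , _)          → inj₁ j∈A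
                   ; (inj₂ _   , inj₁ j∈A)   → inj₁ j∈A
                   ; (inj₂ j∈B , inj₂ j∈C)   → inj₂ (j∈B , j∈C) })
                (Large-∩ (unresize B∈) (unresize C∈)))
            ; ⊆-closed = λ B⊆C B∈ → resize (Large-⊆
                [ inj₁ , (λ j∈B → inj₂ (B⊆C j∈B)) ] (unresize B∈))
            }
          ; isProper = λ ⊥∈ → ¬A-large (Large-⊆ [ id , (λ ()) ] (unresize ⊥∈))
          ; maximal  = maximal
          }
        }
        where
        sets : Pred (Pred I ℓ) ℓ
        sets B = Resize ℓ (Large (A ∪ B))

        maximal : ∀ (F : Pred (Pred I ℓ) ℓ) → IsFilter F → IsProper F → sets ⊆ F → F ⊆ sets
        maximal F F-filter F-proper sets⊆F {B} B∈F with prime B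
        ... | inj₁ A∪B-large  = resize A∪B-large
        -- Here `∁ B` is in `sets`, hence in `F`, so `F` would contain the empty `B ∩ ∁ B`.
        ... | inj₂ A∪∁B-large = contradiction
          (⊆-closed (λ (j∈B , j∉B) → contradiction j∈B j∉B)
            (∩-closed B∈F (sets⊆F (resize A∪∁B-large))))
          F-proper
          where open IsFilter F-filter

      prime-decomposition : Decomposition A
      prime-decomposition = record
        { size          = 1
        ; ultrafilters  = λ _ → residual
        ; ∁∈            = λ _ → resize (Large-full λ j → toSum em)
        ; ∪-large       = λ X∈ → unresize (X∈ Fin.zero)
        -- An ultraproduct has the elements of `∏ H` under a coarser equality, so `y Fin.zero` is
        -- its own preimage.
        ; to∏surjective = λ y → y Fin.zero , λ { Fin.zero →
            Group.refl (ultraproduct H residual) {x = y Fin.zero} }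
        }
    -- If `X` is in all the ultrafilters, then `A ∪ B ∪ X` and `A ∪ ∁ B ∪ X` are large, and their
    -- intersection lies in `A ∪ X`.
    join : ∀ {A} (B : Pred I ℓ) → Decomposition (A ∪ B) → Decomposition (A ∪ ∁ B) →
           Decomposition A
    join {A} B D E = record
      { size          = D.size + E.size
      ; ultrafilters  = D.ultrafilters ++ E.ultrafilters
      ; ∁∈            = ++-elim (λ _ 𝒰 → ∁ A ∈ Ultrafilter.sets 𝒰) D.ultrafilters E.ultrafilters
          (λ m → Ultrafilter.⊆-closed (D.ultrafilters m) (_∘ inj₁) (D.∁∈ m))
          (λ m → Ultrafilter.⊆-closed (E.ultrafilters m) (_∘ inj₁) (E.∁∈ m))
      ; ∪-large       = λ {X} X∈ →
          let X∈D , X∈E = ++⁻ (λ 𝒰 → X ∈ Ultrafilter.sets 𝒰) D.ultrafilters X∈ in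
          Large-⊆
            (λ { (inj₁ (inj₁ j∈A) , _)                 → inj₁ j∈A
               ; (inj₂ j∈X        , _)                 → inj₂ j∈X
               ; (inj₁ (inj₂ _)   , inj₁ (inj₁ j∈A))   → inj₁ j∈A
               ; (inj₁ (inj₂ _)   , inj₂ j∈X)          → inj₂ j∈X
               ; (inj₁ (inj₂ j∈B) , inj₁ (inj₂ j∉B))   → contradiction j∈B j∉B })
            (Large-∩ (D.∪-large X∈D) (E.∪-large X∈E))
      ; to∏surjective = λ y →
          let u , u≈y = D.to∏surjective (λ m → y (m ↑ˡ E.size))
              v , v≈y = E.to∏surjective (λ m → y (D.size ↑ʳ m)) in
          -- The ultrafilters of `D` contain `∁ (A ∪ B)`, on which the glued element is `u`; those
          -- of `E` contain `∁ (A ∪ ∁ B)`, a subset of `B`, on which it is `v`.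
          glue B v u ,
          ++-elim (λ m 𝒰 → (λ j → H._≈_ j (glue B v u j) (y m j)) ∈ Ultrafilter.sets 𝒰)
            D.ultrafilters E.ultrafilters
            (λ m → let open Ultrafilter (D.ultrafilters m) in ⊆-closed
              (λ {j} (j∉A∪B , uj≈yj) → H.trans j (glue-∉ B v u (j∉A∪B ∘ inj₂)) uj≈yj)
              (∩-closed (D.∁∈ m) (u≈y m)))
            (λ m → let open Ultrafilter (E.ultrafilters m) in ⊆-closed
              (λ {j} (j∉A∪∁B , vj≈yj) →
                H.trans j (glue-∈ B v u (decidable-stable em (j∉A∪∁B ∘ inj₂))) vj≈yj)
              (∩-closed (E.∁∈ m) (v≈y m)))
      }
      where
      module D = Decomposition D
      module E = Decomposition E

    -- Termination of the splitting by the chain condition.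

    undecomposable-grows : ∀ {A} → ¬ Decomposition A →
      ∃ λ A′ → ¬ Decomposition A′ × A ⊆ A′ × ¬ Large (A ∪ ∁ A′)
    undecomposable-grows {A} ¬dA
      with em {P = ∃ λ B → ¬ Large (A ∪ B) × ¬ Large (A ∪ ∁ B)}
    -- By `join`, `A ∪ B` and `A ∪ ∁ B` are not both decomposable; take one that is not as `A′`.
    -- Then `A ∪ ∁ A′` lies in the other one, which is not large.
    ... | yes (B , ¬A∪B-large , ¬A∪∁B-large) with em {P = Decomposition (A ∪ B)}
    ...   | no ¬d = A ∪ B , ¬d , inj₁ ,
              ¬A∪∁B-large ∘ Large-⊆ [ inj₁ , (λ j∉A∪B → inj₂ (j∉A∪B ∘ inj₂)) ]
    ...   | yes d = A ∪ ∁ B , (λ e → ¬dA (join B d e)) , inj₁ ,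
              ¬A∪B-large ∘ Large-⊆ [ inj₁ , (λ j∉A∪∁B → inj₂ (decidable-stable em (j∉A∪∁B ∘ inj₂))) ]
    undecomposable-grows {A} ¬dA | no ¬split =
      contradiction (prime-decomposition (¬dA ∘ large-decomposition) prime) ¬dA
      where
      prime : ∀ B → Large (A ∪ B) ⊎ Large (A ∪ ∁ B)
      prime B with em {P = Large (A ∪ B)} | em {P = Large (A ∪ ∁ B)}
      ... | yes l | _     = inj₁ l
      ... | no  _ | yes l = inj₂ l
      ... | no ¬l | no ¬m = contradiction (B , ¬l , ¬m) ¬split

    undecomposable⇒¬chainCondition : ∀ {A} → ¬ Decomposition A →
                                     ¬ ChainConditionOnAlmostDirectFactors K
    undecomposable⇒¬chainCondition {A} ¬dA chainCondition =
      let N , stable = chainCondition (Factor ∘ proj₁ ∘ chain)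
                         (factor-isAlmostDirectFactor ∘ proj₁ ∘ chain)
                         (λ n → factor-mono (proj₁ (proj₂ (proj₂ (next n)))))
      -- Stability at `N` puts factor `suc N` inside factor `N`, which would make `A ∪ ∁ A′` large
      -- at stage `N`.
      in proj₂ (proj₂ (proj₂ (next N)))
           (factor-⊆⇒large _ _ (proj₁ (stable (suc N) (n≤1+n N))))
      where
      chain : ℕ → ∃ λ B → ¬ Decomposition B
      chain zero    = A , ¬dA
      chain (suc n) = let A′ , ¬dA′ , _ = undecomposable-grows (proj₂ (chain n)) in A′ , ¬dA′

      next : ∀ n → ∃ λ A′ → ¬ Decomposition A′ × proj₁ (chain n) ⊆ A′ ×
                            ¬ Large (proj₁ (chain n) ∪ ∁ A′)
      next n = undecomposable-grows (proj₂ (chain n))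

    chainCondition⇒decomposition : ChainConditionOnAlmostDirectFactors K →
                                   ∀ A → Decomposition A
    chainCondition⇒decomposition chainCondition A with em {P = Decomposition A}
    ... | yes d = d
    ... | no ¬d = contradiction chainCondition (undecomposable⇒¬chainCondition ¬d)

-- Factorization through the product of ultraproducts.

proposition10 : (∀ {a} → ExcludedMiddle a) →
    ∀ {i c ℓ k r} {I : Set i} (H : I → Group c ℓ) (K : Group k r)
    (f : GroupHomomorphism (Group.rawGroup (∏ H)) (Group.rawGroup K)) →
    Surjective (Group._≈_ (∏ H)) (Group._≈_ K) (GroupHomomorphism.⟦_⟧ f) →
    ChainConditionOnAlmostDirectFactors K →
    Σ[ n ∈ ℕ ] Σ[ 𝒰 ∈ (Fin n → Ultrafilter I ℓ) ]
    Σ[ g ∈ GroupHomomorphism (Group.rawGroup (∏ultraproducts H 𝒰)) (Group.rawGroup (K /Z)) ]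
    (∀ h → Group._≈_ (K /Z)
    (GroupHomomorphism.⟦_⟧ g (GroupHomomorphism.⟦_⟧ (to∏ultraproducts H 𝒰) h))
    (GroupHomomorphism.⟦_⟧ (toModCenter K) (GroupHomomorphism.⟦_⟧ f h)))
proposition10 em H K f f-surjective chainCondition =
  size , ultrafilters ,
  factor-through-surjection {G = ∏ H} {P = ∏ultraproducts H ultrafilters} {Q = K /Z}
    (to∏ultraproducts H ultrafilters)
    (groupHomomorphism {M₁ = ∏ H} {M₂ = K} {M₃ = K /Z} f (toModCenter K))
    to∏surjective
    -- Equality in every ultraproduct puts the set where `u` and `v` agree in every ultrafilter. The
    -- decomposition is that of the empty set, so `∪-large` makes this set itself large.
    (λ {u} {v} u≈v → Large⇒congruent em H K f strict u v
      (Large-⊆ em H K f strict [ (λ ()) , id ] (∪-large u≈v)))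
  where
  strict : StrictlySurjective (Group._≈_ K) (GroupHomomorphism.⟦_⟧ f)
  strict x = let h , fh≈x = f-surjective x in h , fh≈x (Group.refl (∏ H))

  open Decomposition (chainCondition⇒decomposition em H K f strict chainCondition (λ _ → ⊥))
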